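{- Let $0<k<n$ be integers. Every finite convex subposet $P$ of the cylinder poset $Cyl_{k,n}$ belongs to $\mathcal{N}_2$. Moreover, membership is witnessed by the pair of chain covers of the same form as rows and columns of a rectangular array: $\mathcal{C}_1$ consists of the nonempty intersections of $P$ with the images in $Cyl_{k,n}$ of the horizontal lines $\{(i,j): i\in\mathbb{Z}\}$ ($j$ fixed), and $\mathcal{C}_2$ consists of the nonempty intersections of $P$ with the images of the vertical lines $\{(i,j): j\in\mathbb{Z}\}$ ($i$ fixed).
   Context: For integers $0<k<n$, the cylinder poset $Cyl_{k,n}$ is $\mathbb{Z}^2$ modulo the equivalence relation $(i,j)\sim(i-k,j+n-k)$, i.e. $\mathbb{Z}^2/(-k,n-k)\mathbb{Z}$, with partial order induced by the componentwise order on $\mathbb{Z}^2$ (a class is $\le$ another if they have representatives that are componentwise $\le$). A subset $S$ of a poset is convex if $x\le z\le y$ with $x,y\in S$ implies $z\in S$. An edge of a poset is a covering relation $x\lessdot y$. A chain cover of a poset $P$ is a set of pairwise disjoint saturated chains whose union is $P$. A labeling is a map $\lambda:P\to\mathbb{R}$. For a chain cover $\mathcal{C}$, $\mathcal{C}$-sorting a labeling means: for each chain $\bm{c}\in\mathcal{C}$, permute the labels on $\bm{c}$ so that they are non-decreasing from the minimum of $\bm{c}$ to its maximum. A finite poset $P$ is in $\mathcal{N}_2$ (via $\{\mathcal{C}_1,\mathcal{C}_2\}$) if there is an unordered pair of chain covers $\{\mathcal{C}_1,\mathcal{C}_2\}$ of $P$ such that (1) for every labeling and $i\in\{1,2\}$,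 $\mathcal{C}_i$-sorting and then $\mathcal{C}_{3-i}$-sorting leaves the labels non-decreasing along every chain of $\mathcal{C}_i$; and (2) every edge of $P$ lies in some chain of $\mathcal{C}_1$ or $\mathcal{C}_2$.
   Formalization: If k=1 or n-k=1 with n≥3, rows or columns of P need not be saturated (k=1, n=3, P={(0,0),(0,1),(1,0)}), so there the "Moreover" is proved without saturation: disjoint chains covering P, conditions (1) and (2); membership in N_2 is proved for all 0<k<n. -}

module Defs where

open import Data.Integer.Base using (ℤ; +_; 0ℤ; 1ℤ; -_; _+_; _-_; _*_; _≤_; _<_; Positive; positive)
open import Data.Integer.Properties as ℤ using ()
open import Data.Integer.Tactic.RingSolver using (solve-∀)
open import Data.List.Relation.Unary.Enumerates.Setoid using (IsEnumeration)
open import Data.Product.Base using (∃; ∃₂; ∃-syntax; _×_; _,_; proj₁; proj₂)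
open import Data.Product.Relation.Binary.Pointwise.NonDependent using (Pointwise)
open import Data.Sum.Base using (_⊎_)
open import Function.Bundles using (Func; Inverse)
open import Level using (Level; 0ℓ; _⊔_) renaming (suc to lsuc)
open import Relation.Binary.Bundles using (Setoid; Poset; TotalOrder)
open import Relation.Binary.Core using (Rel)
open import Relation.Binary.Definitions using (_Respects_)
import Relation.Binary.Construct.NonStrictToStrict as ToStrict
import Relation.Binary.Construct.On as On
open import Relation.Binary.PropositionalEquality using (_≡_; refl; sym; trans; cong; cong₂; subst; subst₂)
open import Relation.Nullary.Negation.Core using (¬_)
open import Relation.Unary using (Pred; _∈_; _≐_; _≬_; _⊢_; Satisfiable)

private
  variable
    a ℓ₁ ℓ₂ : Level

-- A subset of a poset is a predicate; wherever one is used as a subset it is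
-- also required to respect the poset's equality.

Finite : Setoid 0ℓ 0ℓ → Set
Finite S = ∃[ xs ] IsEnumeration S xs

Induced : (Q : Poset 0ℓ 0ℓ 0ℓ) → Pred (Poset.Carrier Q) 0ℓ → Poset 0ℓ 0ℓ 0ℓ
Induced Q S = On.poset Q (proj₁ {B = S})

module PosetNotions (Q : Poset 0ℓ 0ℓ 0ℓ) where

  open Poset Q using (Carrier; _≈_) renaming (_≤_ to _⊑_)
  open ToStrict _≈_ _⊑_ using () renaming (_<_ to _⊏_)

  IsConvex : Pred Carrier 0ℓ → Set
  IsConvex S = ∀ {x y z} → x ∈ S → y ∈ S → x ⊑ z → z ⊑ y → z ∈ S

  _⋖_ : Rel Carrier 0ℓ
  x ⋖ y = x ⊏ y × ¬ (∃[ z ] (x ⊏ z × z ⊏ y))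

  record IsChain (c : Pred Carrier 0ℓ) : Set where
    field
      respects   : c Respects _≈_
      comparable : ∀ {x y} → x ∈ c → y ∈ c → x ⊑ y ⊎ y ⊑ x

  -- No element outside c lies strictly between two elements of c and can be
  -- added to c so that the result is still a chain.
  IsSaturated : Pred Carrier 0ℓ → Set
  IsSaturated c = ∀ {x y z} → x ∈ c → y ∈ c → x ⊏ z → z ⊏ y →
                  (∀ {w} → w ∈ c → w ⊑ z ⊎ z ⊑ w) → z ∈ c

  -- A set of subsets; its members are compared by extensional equality _≐_.
  Family : Set₁
  Family = Pred (Pred Carrier 0ℓ) 0ℓ

  -- Pairwise disjointness: two members that meet (_≬_) are the same subset.
  record IsChainPartition (C : Family) : Set₁ where
    field
      chains   : ∀ {c} → c ∈ C → IsChain c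
      disjoint : ∀ {c d} → c ∈ C → d ∈ C → c ≬ d → c ≐ d
      union    : ∀ x → ∃[ c ] (c ∈ C × x ∈ c)

  record IsChainCover (C : Family) : Set₁ where
    field
      isChainPartition : IsChainPartition C
      saturated        : ∀ {c} → c ∈ C → IsSaturated c

  EdgesIn : Family → Family → Set₁
  EdgesIn C₁ C₂ = ∀ {x y} → x ⋖ y →
                  ∃[ c ] ((c ∈ C₁ ⊎ c ∈ C₂) × x ∈ c × y ∈ c)

  module Labelled (L : TotalOrder a ℓ₁ ℓ₂) where

    open TotalOrder L using () renaming (_≈_ to _≈ᴸ_; _≤_ to _≤ᴸ_)
    open Func using (to)

    Labelling : Set (a ⊔ ℓ₁)
    Labelling = Func (Poset.Eq.setoid Q) (TotalOrder.Eq.setoid L)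

    NonDecreasingOn : Pred Carrier 0ℓ → Labelling → Set ℓ₂
    NonDecreasingOn c ν = ∀ {x y} → x ∈ c → y ∈ c → x ⊑ y → to ν x ≤ᴸ to ν y

    PermutedOn : Pred Carrier 0ℓ → Labelling → Labelling → Set ℓ₁
    PermutedOn c ν μ =
      ∃[ σ ] (∀ x → to μ (proj₁ x) ≈ᴸ to ν (proj₁ (Inverse.to {From = c-setoid} {To = c-setoid} σ x)))
      where c-setoid = Poset.Eq.setoid (Induced Q c)

    -- SortsTo C ν μ: the labelling μ is a result of C-sorting ν. For a chain
    -- cover of a finite poset such a μ exists and is unique up to equality of
    -- labels.
    SortsTo : Family → Labelling → Labelling → Set (lsuc 0ℓ ⊔ ℓ₁ ⊔ ℓ₂)
    SortsTo C ν μ = ∀ {c} → c ∈ C → PermutedOn c ν μ × NonDecreasingOn c μ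

    SortThenSort : Family → Family → Set (lsuc 0ℓ ⊔ a ⊔ ℓ₁ ⊔ ℓ₂)
    SortThenSort C D = ∀ {ν μ ρ} → SortsTo C ν μ → SortsTo D μ ρ →
                       ∀ {c} → c ∈ C → NonDecreasingOn c ρ

    record NonMessingUp (C₁ C₂ : Family) : Set (lsuc 0ℓ ⊔ a ⊔ ℓ₁ ⊔ ℓ₂) where
      field
        sort₁₂ : SortThenSort C₁ C₂
        sort₂₁ : SortThenSort C₂ C₁
        edges  : EdgesIn C₁ C₂

    record InN₂Via (C₁ C₂ : Family) : Set (lsuc 0ℓ ⊔ a ⊔ ℓ₁ ⊔ ℓ₂) where
      field
        finite       : Finite (Poset.Eq.setoid Q)
        cover₁       : IsChainCover C₁
        cover₂       : IsChainCover C₂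
        nonMessingUp : NonMessingUp C₁ C₂

    -- The class 𝒩₂ for labels in L. Of the real numbers, the definition uses
    -- only their total order, so labels range over an arbitrary total order L;
    -- L = ℝ is the usual class.
    InN₂ : Set (lsuc 0ℓ ⊔ a ⊔ ℓ₁ ⊔ ℓ₂)
    InN₂ = ∃₂ InN₂Via

module Cylinder (k n : ℤ) where

  shift : ℤ → ℤ × ℤ → ℤ × ℤ
  shift m (i , j) = i - m * k , j + m * (n - k)

  _∼_ : Rel (ℤ × ℤ) 0ℓ
  x ∼ y = ∃[ m ] y ≡ shift m x

  _≤²_ : Rel (ℤ × ℤ) 0ℓ
  _≤²_ = Pointwise _≤_ _≤_

  _≼_ : Rel (ℤ × ℤ) 0ℓ
  x ≼ y = ∃₂ λ x′ y′ → x ∼ x′ × y ∼ y′ × x′ ≤² y′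

  -- The images in the cylinder of { (i , j) : i ∈ ℤ } and { (i , j) : j ∈ ℤ }.
  HorizontalLine : ℤ → Pred (ℤ × ℤ) 0ℓ
  HorizontalLine j x = ∃[ i ] x ∼ (i , j)

  VerticalLine : ℤ → Pred (ℤ × ℤ) 0ℓ
  VerticalLine i x = ∃[ j ] x ∼ (i , j)

  -- For 0 < k < n, exactly the condition that every (i , j) is covered in the
  -- cylinder by both (i + 1 , j) and (i , j + 1). If k = 1 then
  -- (i + 1 , j) ∼ (i , j + n - 1), so for n > 2 the element (i , j + 1) lies
  -- strictly between (i , j) and (i + 1 , j), and horizontal lines are chains
  -- but not saturated; symmetrically for vertical lines if n - k = 1. Saturation
  -- of the intersections with lines therefore needs this hypothesis.
  UnitStepsCover : Set
  UnitStepsCover = (1ℤ < k × 1ℤ < n - k) ⊎ n ≡ + 2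

  shift-0 : ∀ x → x ≡ shift 0ℤ x
  shift-0 (i , j) = cong₂ _,_ (e₁ i k) (e₂ j k n)
    where
    e₁ : ∀ i k → i ≡ i - 0ℤ * k
    e₁ = solve-∀
    e₂ : ∀ j k n → j ≡ j + 0ℤ * (n - k)
    e₂ = solve-∀

  shift-+ : ∀ s t x → shift s (shift t x) ≡ shift (s + t) x
  shift-+ s t (i , j) = cong₂ _,_ (e₁ s t i k) (e₂ s t j k n)
    where
    e₁ : ∀ s t i k → i - t * k - s * k ≡ i - (s + t) * k
    e₁ = solve-∀
    e₂ : ∀ s t j k n → j + t * (n - k) + s * (n - k) ≡ j + (s + t) * (n - k)
    e₂ = solve-∀

  shift-inv : ∀ m x → x ≡ shift (- m) (shift m x)
  shift-inv m (i , j) = cong₂ _,_ (e₁ m i k) (e₂ m j k n)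
    where
    e₁ : ∀ m i k → i ≡ i - m * k - - m * k
    e₁ = solve-∀
    e₂ : ∀ m j k n → j ≡ j + m * (n - k) + - m * (n - k)
    e₂ = solve-∀

  shift-mono : ∀ m x y → x ≤² y → shift m x ≤² shift m y
  shift-mono m _ _ (p , q) = ℤ.+-monoˡ-≤ (- (m * k)) p , ℤ.+-monoˡ-≤ (m * (n - k)) q

  ≤²-trans : ∀ x y z → x ≤² y → y ≤² z → x ≤² z
  ≤²-trans _ _ _ (p , q) (p′ , q′) = ℤ.≤-trans p p′ , ℤ.≤-trans q q′

  ≤²-antisym : ∀ x y → x ≤² y → y ≤² x → x ≡ y
  ≤²-antisym _ _ (p , q) (p′ , q′) = cong₂ _,_ (ℤ.≤-antisym p p′) (ℤ.≤-antisym q q′)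

  ∼-refl : ∀ x → x ∼ x
  ∼-refl x = 0ℤ , shift-0 x

  ∼-sym : ∀ x y → x ∼ y → y ∼ x
  ∼-sym x _ (m , refl) = - m , shift-inv m x

  ∼-trans : ∀ x y z → x ∼ y → y ∼ z → x ∼ z
  ∼-trans x _ _ (s , refl) (t , refl) = t + s , shift-+ t s x

  ≼-shift : ∀ x y → x ≼ y → ∃[ m ] x ≤² shift m y
  ≼-shift x y (_ , _ , (s , refl) , (t , refl) , p) = - s + t ,
    subst₂ _≤²_ (sym (shift-inv s x)) (shift-+ (- s) t y)
      (shift-mono (- s) (shift s x) (shift t y) p)

  shift-≼ : ∀ x y m → x ≤² shift m y → x ≼ y
  shift-≼ x y m p = x , shift m y , ∼-refl x , (m , refl) , p

  shift-≤²-trans : ∀ x y z s t → x ≤² shift s y → y ≤² shift t z → x ≤² shift (s + t) z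
  shift-≤²-trans x y z s t p q =
    subst (x ≤²_) (shift-+ s t z)
      (≤²-trans x (shift s y) (shift s (shift t z)) p (shift-mono s y (shift t z) q))

  ≼-trans : ∀ x y z → x ≼ y → y ≼ z → x ≼ z
  ≼-trans x y z x≼y y≼z =
    let (s , p) = ≼-shift x y x≼y
        (t , q) = ≼-shift y z y≼z
    in shift-≼ x z (s + t) (shift-≤²-trans x y z s t p q)

  module _ (0<k : 0ℤ < k) (k<n : k < n) where

    private instance
      k-pos : Positive k
      k-pos = positive 0<k

      n-k-pos : Positive (n - k)
      n-k-pos = positive (subst (_< n - k) (ℤ.+-inverseʳ k) (ℤ.+-monoˡ-< (- k) k<n))

    shift-≤⇒0 : ∀ m x → x ≤² shift m x → m ≡ 0ℤ
    shift-≤⇒0 m (i , j) (p , q) = ℤ.≤-antisym m≤0 0≤m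
      where
      e₁ : ∀ m i k → i + (m * k - i) ≡ m * k
      e₁ = solve-∀
      e₂ : ∀ m i k → i - m * k + (m * k - i) ≡ 0ℤ * k
      e₂ = solve-∀
      e₃ : ∀ j k n → j - j ≡ 0ℤ * (n - k)
      e₃ = solve-∀
      e₄ : ∀ m j k n → j + m * (n - k) - j ≡ m * (n - k)
      e₄ = solve-∀
      m≤0 : m ≤ 0ℤ
      m≤0 = ℤ.*-cancelʳ-≤-pos m 0ℤ k (subst₂ _≤_ (e₁ m i k) (e₂ m i k) (ℤ.+-monoˡ-≤ (m * k - i) p))
      0≤m : 0ℤ ≤ m
      0≤m = ℤ.*-cancelʳ-≤-pos 0ℤ m (n - k) (subst₂ _≤_ (e₃ j k n) (e₄ m j k n) (ℤ.+-monoˡ-≤ (- j) q))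

    ≼-antisym : ∀ x y → x ≼ y → y ≼ x → x ∼ y
    ≼-antisym x y x≼y y≼x =
      let (s , p) = ≼-shift x y x≼y
          (t , q) = ≼-shift y x y≼x
          s+t≡0   = shift-≤⇒0 (s + t) x (shift-≤²-trans x y x s t p q)
          q′ : shift s y ≤² x
          q′ = subst (shift s y ≤²_)
                 (trans (shift-+ s t x) (trans (cong (λ m → shift m x) s+t≡0) (sym (shift-0 x))))
                 (shift-mono s y (shift t x) q)
      in ∼-sym y x (s , ≤²-antisym x (shift s y) p q′)

  Cyl : 0ℤ < k → k < n → Poset 0ℓ 0ℓ 0ℓ
  Cyl 0<k k<n = record
    { Carrier = ℤ × ℤ
    ; _≈_     = _∼_
    ; _≤_     = _≼_
    ; isPartialOrder = record
      { isPreorder = record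
        { isEquivalence = record
          { refl  = λ {x} → ∼-refl x
          ; sym   = λ {x y} → ∼-sym x y
          ; trans = λ {x y z} → ∼-trans x y z
          }
        ; reflexive     = λ {x y} x∼y → x , x , ∼-refl x , ∼-sym x y x∼y , ℤ.≤-refl , ℤ.≤-refl
        ; trans         = λ {x y z} → ≼-trans x y z
        }
      ; antisym = λ {x y} → ≼-antisym 0<k k<n x y
      }
    }

  -- The families of nonempty intersections of P with the lines, as families of
  -- subsets of the subposet P (whose carrier is ∃ P).
  module _ (P : Pred (ℤ × ℤ) 0ℓ) where

    Rows : Pred (Pred (∃ P) 0ℓ) 0ℓ
    Rows c = Satisfiable c × ∃[ j ] c ≐ (proj₁ ⊢ HorizontalLine j)

    Columns : Pred (Pred (∃ P) 0ℓ) 0ℓ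
    Columns c = Satisfiable c × ∃[ i ] c ≐ (proj₁ ⊢ VerticalLine i)

{-# OPTIONS --safe #-}
module Submission where

-- Lift the cylinder to ℤ²: the preimage of P is convex, so if (i , j) ≼ (i′ , j)
-- are in the same row, then below j the column i is contained in the column i′,
-- and above j the column i′ is contained in the column i. Suppose the rows were
-- sorted first (labels μ) and then the columns (labels ρ), by permutations σ of the
-- column i′ and π of the column i, and let τ be the inverse of π. Starting from
-- t = j, follow t ↦ σ t in the column i′ and, when (i , σ t) is in P, continue to
-- τ (σ t) in the column i. These moves are injective and the poset is finite, so
-- at some t ≤ j the result is a u = τ (σ t) ≥ j; then
-- ρ (i , j) ≤ ρ (i , u) = μ (i , σ t) ≤ μ (i′ , σ t) = ρ (i′ , t) ≤ ρ (i′ , j).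
--
-- If k = 1 or n - k = 1, the cylinder is a chain, and P itself is a chain cover.

open import Data.Fin.Base using (Fin; toℕ)
open import Data.Fin.Properties using (pigeonhole)
open import Data.Integer.Base
  using (ℤ; +_; 0ℤ; 1ℤ; -1ℤ; -_; ∣_∣; _+_; _-_; _*_; _≤_; _<_; Positive; positive; nonNegative; >-nonZero)
open import Data.Integer.Divisibility.Signed using (_∣?_; divides)
open import Data.Integer.Properties as ℤ using (_≤?_; _≟_)
open import Data.Integer.Tactic.RingSolver using (solve-∀)
open import Data.List.Base using (length)
open import Data.List.Membership.Setoid.Properties using (index-injective)
import Data.List.Relation.Unary.Any as Any
open import Data.Nat.Base as ℕ using (ℕ; zero; suc; s<s)
open import Data.Nat.GeneralisedArithmetic using (fold)
import Data.Nat.Properties as ℕ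
open import Data.Product.Base using (∃; ∃₂; ∃-syntax; _×_; _,_; proj₁; proj₂)
open import Data.Product.Properties using (≡-dec)
open import Data.Sum.Base as Sum using (_⊎_; inj₁; inj₂)
open import Function.Base using (id; flip; _∘_)
open import Function.Bundles using (Func; Inverse)
open import Level using (Level; 0ℓ)
open import Relation.Binary.Bundles using (Poset; TotalOrder)
open import Relation.Binary.Definitions using (_Respects_; tri<; tri≈; tri>)
open import Relation.Binary.PropositionalEquality using (_≡_; refl; sym; trans; cong; cong₂; subst)
import Relation.Binary.Reasoning.PartialOrder as ≤-Reasoning
open import Relation.Nullary.Decidable using (Dec; yes; no; map′)
open import Relation.Nullary.Negation.Core using (¬_; contradiction)
open import Relation.Unary using (Pred; Decidable; Satisfiable; U; _⊆_; _≐_; _∈_; _⊢_)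
open import Defs

-- A and B are the columns i and i′ of the two points to be compared.
module Chase
  {A B : Pred ℤ 0ℓ} (A? : Decidable A) (j : ℤ)
  (A⇒B : ∀ {t} → t ≤ j → A t → B t) (B⇒A : ∀ {t} → j ≤ t → B t → A t)
  (σ : ∃ B → ∃ B) (σ-injective : ∀ s t → proj₁ (σ s) ≡ proj₁ (σ t) → proj₁ s ≡ proj₁ t)
  (τ : ∃ A → ∃ A) (τ-injective : ∀ s t → proj₁ (τ s) ≡ proj₁ (τ t) → proj₁ s ≡ proj₁ t)
  {N : ℕ} (index : ∃ B → Fin N)
  (index-inj : ∀ s t → index s ≡ index t → proj₁ s ≡ proj₁ t)
  where

  Crossing : Set
  Crossing = ∃₂ λ (t : ∃ B) (p : A (proj₁ (σ t))) → proj₁ t ≤ j × j ≤ proj₁ (τ (proj₁ (σ t) , p))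

  private
    next′ : (t : ∃ B) → Dec (A (proj₁ (σ t))) → ℤ
    next′ t (yes p) = proj₁ (τ (proj₁ (σ t) , p))
    next′ t (no _)  = proj₁ (σ t)

    next : ∃ B → ℤ
    next t = next′ t (A? (proj₁ (σ t)))

    next-injective : ∀ s t → next s ≡ next t → proj₁ s ≡ proj₁ t
    next-injective s t eq with A? (proj₁ (σ s)) | A? (proj₁ (σ t))
    ... | yes p | yes q = σ-injective s t (τ-injective _ _ eq)
    ... | yes p | no ¬q = contradiction (subst A eq (proj₂ (τ (_ , p)))) ¬q
    ... | no ¬p | yes q = contradiction (subst A (sym eq) (proj₂ (τ (_ , q)))) ¬p
    ... | no ¬p | no ¬q = σ-injective s t eq

    crossing : ∀ t → proj₁ t ≤ j → j ≤ next t → Crossing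
    crossing t t≤j j≤ with A? (proj₁ (σ t))
    ... | yes p = t , p , t≤j , j≤
    ... | no ¬p = contradiction (B⇒A j≤ (proj₂ (σ t))) ¬p

    next∈B : ∀ t → next t ≤ j → B (next t)
    next∈B t ≤j with A? (proj₁ (σ t))
    ... | yes p = A⇒B ≤j (proj₂ (τ (_ , p)))
    ... | no  _ = proj₂ (σ t)

    State : Set
    State = ∃ λ (t : ∃ B) → proj₁ t ≤ j

    at : State → ℤ
    at = proj₁ ∘ proj₁

  module _ (j∈B : B j) where

    private
      start : State
      start = (j , j∈B) , ℤ.≤-refl

      step′ : (s : State) → Dec (j ≤ next (proj₁ s)) → State
      step′ (t , _) (yes _) = start
      step′ (t , _) (no j≰) = (next t , next∈B t ≤j) , ≤j
        where ≤j = ℤ.<⇒≤ (ℤ.≰⇒> j≰)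

      step : State → State
      step s = step′ s (j ≤? next (proj₁ s))

      orbit : ℕ → State
      orbit = fold start step

      -- Injectivity traces equal positions back until the earlier one is the start j
      -- or the orbit restarts; in both cases some move ends at j or above.
      collision : ∀ p q → p ℕ.< q → at (orbit p) ≡ at (orbit q) → Crossing
      collision zero (suc q) _ eq with j ≤? next (proj₁ (orbit q))
      ... | yes j≤ = crossing _ (proj₂ (orbit q)) j≤
      ... | no j≰  = contradiction (ℤ.≤-reflexive eq) j≰
      collision (suc p) (suc q) (s<s p<q) eq
        with j ≤? next (proj₁ (orbit p)) | j ≤? next (proj₁ (orbit q))
      ... | yes j≤ | _      = crossing _ (proj₂ (orbit p)) j≤
      ... | no _   | yes j≤ = crossing _ (proj₂ (orbit q)) j≤
      ... | no _   | no _   = collision p q p<q (next-injective _ _ eq)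

    ∃-crossing : Crossing
    ∃-crossing =
      let (p , q , p<q , eq) = pigeonhole (ℕ.n<1+n N) (index ∘ proj₁ ∘ orbit ∘ toℕ)
      in collision (toℕ p) (toℕ q) p<q (index-inj _ _ eq)

≤+*⇒nonNeg : ∀ {a b} m d .{{_ : Positive d}} → a ≤ b + m * d → b < a + d → 0ℤ ≤ m
≤+*⇒nonNeg {a} {b} m d a≤ b< = ℤ.≮⇒≥ λ m<0 → ℤ.<⇒≱ (below m<0) a≤
  where
  open ℤ.≤-Reasoning
  0≤d = nonNegative (ℤ.<⇒≤ (ℤ.positive⁻¹ d))
  e : ∀ a d → a + d + -1ℤ * d ≡ a
  e = solve-∀
  below : m < 0ℤ → b + m * d < a
  below m<0 = begin-strict
    b + m * d          <⟨ ℤ.+-monoˡ-< (m * d) b< ⟩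
    a + d + m * d      ≤⟨ ℤ.+-monoʳ-≤ (a + d) (ℤ.*-monoʳ-≤-nonNeg d {{0≤d}} (ℤ.i<j⇒i≤pred[j] m<0)) ⟩
    a + d + -1ℤ * d    ≡⟨ e a d ⟩
    a                  ∎

≤-*⇒nonPos : ∀ {a b} m d .{{_ : Positive d}} → a ≤ b - m * d → b < a + d → m ≤ 0ℤ
≤-*⇒nonPos {a} {b} m d a≤ b< = subst (_≤ 0ℤ) (ℤ.neg-involutive m)
  (ℤ.neg-mono-≤ (≤+*⇒nonNeg (- m) d (subst (a ≤_) (cong (λ c → b + c) (ℤ.neg-distribˡ-* m d)) a≤) b<))

i<i+pos : ∀ i d .{{_ : Positive d}} → i < i + d
i<i+pos i d = subst (_< i + d) (ℤ.+-identityʳ i) (ℤ.+-monoʳ-< i (ℤ.positive⁻¹ d))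

+nonPos*≤ : ∀ b {m} d .{{_ : Positive d}} → m ≤ 0ℤ → b + m * d ≤ b
+nonPos*≤ b {m} d m≤0 = subst (b + m * d ≤_) (e b d)
  (ℤ.+-monoʳ-≤ b (ℤ.*-monoʳ-≤-nonNeg d {{nonNegative (ℤ.<⇒≤ (ℤ.positive⁻¹ d))}} m≤0))
  where
  e : ∀ b d → b + 0ℤ * d ≡ b
  e = solve-∀

-nonNeg*≤ : ∀ b {m} d .{{_ : Positive d}} → 0ℤ ≤ m → b - m * d ≤ b
-nonNeg*≤ b {m} d 0≤m = subst (_≤ b) (cong (λ c → b + c) (sym (ℤ.neg-distribˡ-* m d)))
  (+nonPos*≤ b d (ℤ.neg-mono-≤ 0≤m))

Whole : ∀ {A : Set} → Pred (Pred A 0ℓ) 0ℓ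
Whole c = ∀ x → x ∈ c

module _ {R : Poset 0ℓ 0ℓ 0ℓ} {a ℓ₁ ℓ₂ : Level} (L : TotalOrder a ℓ₁ ℓ₂) where

  private module R = Poset R
  open PosetNotions R
  open Labelled L

  chain⇒InN₂Via : Finite R.Eq.setoid → (∀ x y → x R.≤ y ⊎ y R.≤ x) → InN₂Via Whole Whole
  chain⇒InN₂Via finite total = record
    { finite = finite
    ; cover₁ = whole-cover
    ; cover₂ = whole-cover
    ; nonMessingUp = record
      { sort₁₂ = λ _ sorted c∈ → proj₂ (sorted c∈)
      ; sort₂₁ = λ _ sorted c∈ → proj₂ (sorted c∈)
      ; edges  = λ _ → U , inj₁ (λ _ → _) , _ , _
      }
    }
    where
    whole-cover : IsChainCover Whole
    whole-cover = record
      { isChainPartition = record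
        { chains   = λ all → record { respects = λ _ _ → all _ ; comparable = λ _ _ → total _ _ }
        ; disjoint = λ all all′ _ → (λ _ → all′ _) , (λ _ → all _)
        ; union    = λ x → U , (λ _ → _) , _
        }
      ; saturated = λ all _ _ _ _ _ → all _
      }

-- On the cylinder, pt i j is the class of (i , j) or, to exchange rows and columns,
-- of (j , i); a point has several pairs of coordinates.
module Grid (Q : Poset 0ℓ 0ℓ 0ℓ) where

  private module Q = Poset Q
  open Q using (Carrier; _≈_) renaming (_≤_ to _⊑_)

  ⊑-resp-≈ : ∀ {x x′ y y′} → x ≈ x′ → y ≈ y′ → x′ ⊑ y′ → x ⊑ y
  ⊑-resp-≈ x≈x′ y≈y′ x′⊑y′ = Q.trans (Q.reflexive x≈x′) (Q.trans x′⊑y′ (Q.reflexive (Q.Eq.sym y≈y′)))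

  record Coordinates : Set where
    field
      pt        : ℤ → ℤ → Carrier
      lifts     : ∀ {x y} → x ⊑ y → ∃₂ λ i t → ∃₂ λ i′ t′ →
                  x ≈ pt i t × y ≈ pt i′ t′ × i ≤ i′ × t ≤ t′
      mono      : ∀ {i i′ t t′} → i ≤ i′ → t ≤ t′ → pt i t ⊑ pt i′ t′
      reflectsˡ : ∀ {i i′ t} → pt i t ⊑ pt i′ t → i ≤ i′
      reflectsʳ : ∀ {i t t′} → pt i t ⊑ pt i t′ → t ≤ t′
      parallelˡ : ∀ {i i′ t t′} → pt i t ≈ pt i′ t′ → ∀ s → ∃[ s′ ] pt s t ≈ pt s′ t′
      parallelʳ : ∀ {i i′ t t′} → pt i t ≈ pt i′ t′ → ∀ s → ∃[ s′ ] pt i s ≈ pt i′ s′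

    Line : ℤ → Pred Carrier 0ℓ
    Line i x = ∃[ t ] x ≈ pt i t

    Line-resp : ∀ {i} → Line i Respects _≈_
    Line-resp x≈y (t , x≈) = t , Q.Eq.trans (Q.Eq.sym x≈y) x≈

    Line-comparable : ∀ {i x y} → x ∈ Line i → y ∈ Line i → x ⊑ y ⊎ y ⊑ x
    Line-comparable (t , x≈) (t′ , y≈) with ℤ.≤-total t t′
    ... | inj₁ t≤t′ = inj₁ (⊑-resp-≈ x≈ y≈ (mono ℤ.≤-refl t≤t′))
    ... | inj₂ t′≤t = inj₂ (⊑-resp-≈ y≈ x≈ (mono ℤ.≤-refl t′≤t))

    Line-⊆ : ∀ {i i′ x} → x ∈ Line i → x ∈ Line i′ → Line i ⊆ Line i′
    Line-⊆ (_ , x≈) (_ , x≈′) (s , y≈) =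
      let (s′ , eq) = parallelʳ (Q.Eq.trans (Q.Eq.sym x≈) x≈′) s in s′ , Q.Eq.trans y≈ eq

    injectiveˡ : ∀ {i i′ t} → pt i t ≈ pt i′ t → i ≡ i′
    injectiveˡ eq = ℤ.≤-antisym (reflectsˡ (Q.reflexive eq)) (reflectsˡ (Q.reflexive (Q.Eq.sym eq)))

    injectiveʳ : ∀ {i t t′} → pt i t ≈ pt i t′ → t ≡ t′
    injectiveʳ eq = ℤ.≤-antisym (reflectsʳ (Q.reflexive eq)) (reflectsʳ (Q.reflexive (Q.Eq.sym eq)))

    StepsCover : Set
    StepsCover = ∀ i t z → pt i t ⊑ z → z ⊑ pt i (1ℤ + t) → z ∈ Line i

  transpose : Coordinates → Coordinates
  transpose C = record
    { pt        = flip pt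
    ; lifts     = λ x⊑y → let (i , t , i′ , t′ , x≈ , y≈ , i≤i′ , t≤t′) = lifts x⊑y
                          in t , i , t′ , i′ , x≈ , y≈ , t≤t′ , i≤i′
    ; mono      = flip mono
    ; reflectsˡ = reflectsʳ
    ; reflectsʳ = reflectsˡ
    ; parallelˡ = parallelʳ
    ; parallelʳ = parallelˡ
    }
    where open Coordinates C

  module Preimages {A : Set} (f : A → Carrier) (C : Coordinates) where

    open Coordinates C using (Line)
    open Coordinates (transpose C) using () renaming (Line to Cross)

    lineOf crossOf : ℤ → Pred A 0ℓ
    lineOf  i = f ⊢ Line i
    crossOf t = f ⊢ Cross t

    Lines Crosses : Pred (Pred A 0ℓ) 0ℓ
    Lines   c = Satisfiable c × ∃[ i ] c ≐ lineOf i
    Crosses c = Satisfiable c × ∃[ t ] c ≐ crossOf t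

  -- Subposets enter as convex embeddings of an abstract poset R: comparing two
  -- elaborations of Induced (Cyl _ _) P unfolds all the order axioms.
  record IsConvexEmbedding (R : Poset 0ℓ 0ℓ 0ℓ) (embed : Poset.Carrier R → Carrier) : Set where
    constructor isConvexEmbedding
    private module R = Poset R
    field
      cong-≈    : ∀ {x y} → x R.≈ y → embed x ≈ embed y
      cancel-≈  : ∀ {x y} → embed x ≈ embed y → x R.≈ y
      mono-⊑    : ∀ {x y} → x R.≤ y → embed x ⊑ embed y
      cancel-⊑  : ∀ {x y} → embed x ⊑ embed y → x R.≤ y
      convex    : ∀ x y {z} → embed x ⊑ z → z ⊑ embed y → ∃[ w ] embed w ≈ z

  module Families {R : Poset 0ℓ 0ℓ 0ℓ} {embed : Poset.Carrier R → Carrier} (E : IsConvexEmbedding R embed)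
    (_≈?_ : ∀ x y → Dec (x ≈ y)) (finite : Finite (Poset.Eq.setoid R)) where

    open IsConvexEmbedding E
    open PosetNotions R

    private
      module R = Poset R
      xs = proj₁ finite
      enumerates = proj₂ finite

    Image : Pred Carrier 0ℓ
    Image z = ∃[ w ] embed w ≈ z

    Image? : Decidable Image
    Image? z = map′ Any.satisfied
      (λ (w , w≈z) → Any.map (λ w≈v → Q.Eq.trans (Q.Eq.sym (cong-≈ w≈v)) w≈z) (enumerates w))
      (Any.any? (λ w → embed w ≈? z) xs)

    Image-convex : ∀ {x y z} → x ∈ Image → y ∈ Image → x ⊑ z → z ⊑ y → z ∈ Image
    Image-convex (v , v≈x) (w , w≈y) x⊑z z⊑y =
      convex v w (Q.trans (Q.reflexive v≈x) x⊑z) (Q.trans z⊑y (Q.reflexive (Q.Eq.sym w≈y)))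

    module Along (C : Coordinates) where

      open Coordinates C
      open Preimages embed C

      partition : IsChainPartition Lines
      partition = record
        { chains = λ where
            (_ , i , ⊆l , l⊆) → record
              { respects   = λ x≈y x∈c → l⊆ (Line-resp (cong-≈ x≈y) (⊆l x∈c))
              ; comparable = λ x∈c y∈c → Sum.map cancel-⊑ cancel-⊑ (Line-comparable (⊆l x∈c) (⊆l y∈c))
              }
        ; disjoint = λ where
            (_ , i , ⊆l , l⊆) (_ , i′ , ⊆l′ , l⊆′) (x , x∈c , x∈d) →
              (λ y∈c → l⊆′ (Line-⊆ (⊆l x∈c) (⊆l′ x∈d) (⊆l y∈c))) ,
              (λ y∈d → l⊆ (Line-⊆ (⊆l′ x∈d) (⊆l x∈c) (⊆l′ y∈d)))
        ; union = λ x → let (i , t , _ , _ , x≈ , _) = lifts (Q.refl {embed x}) in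
            lineOf i , ((x , t , x≈) , i , id , id) , t , x≈
        }

      module _ (stepsCover : StepsCover) where

        private
          walk : ∀ {i z} d {t} → Image (pt i t) → Image (pt i (+ d + t)) →
                 pt i t ⊑ z → z ⊑ pt i (+ d + t) →
                 (∀ s → Image (pt i s) → pt i s ⊑ z ⊎ z ⊑ pt i s) → z ∈ Line i
          walk {i} {z} zero {t} p q t⊑z z⊑t _ =
            t , Q.antisym (subst (λ s → z ⊑ pt i s) (ℤ.+-identityˡ t) z⊑t) t⊑z
          walk {i} {z} (suc d) {t} p q t⊑z z⊑ cmp = go (cmp (1ℤ + t) p′)
            where
            e : + suc d + t ≡ + d + (1ℤ + t)
            e = trans (cong (λ c → c + t) (trans (ℤ.pos-+ 1 d) (ℤ.+-comm 1ℤ (+ d))))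
                  (ℤ.+-assoc (+ d) 1ℤ t)
            p′ : Image (pt i (1ℤ + t))
            p′ = Image-convex p q (mono ℤ.≤-refl (ℤ.i≤j+i t 1ℤ))
              (mono ℤ.≤-refl (subst (1ℤ + t ≤_) (sym e) (ℤ.i≤j+i (1ℤ + t) (+ d))))
            go : pt i (1ℤ + t) ⊑ z ⊎ z ⊑ pt i (1ℤ + t) → z ∈ Line i
            go (inj₁ ⊑z) = walk d p′ (subst (Image ∘ pt i) e q) ⊑z (subst (λ s → z ⊑ pt i s) e z⊑) cmp
            go (inj₂ z⊑′) = stepsCover _ _ _ t⊑z z⊑′

        saturated-line : ∀ {c} → c ∈ Lines → IsSaturated c
        saturated-line {c} (_ , i , ⊆l , l⊆) {x} {y} {z} x∈c y∈c (x⊑z , _) (z⊑y , _) cmp =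
          let (t , x≈)  = ⊆l x∈c
              (t′ , y≈) = ⊆l y∈c
              x⊑        = Q.trans (Q.reflexive (Q.Eq.sym x≈)) (mono-⊑ x⊑z)
              ⊑y        = Q.trans (mono-⊑ z⊑y) (Q.reflexive y≈)
              t′≡       = distance (reflectsʳ (Q.trans x⊑ ⊑y))
          in l⊆ (walk ∣ t′ - t ∣ (x , x≈) (subst (Image ∘ pt i) t′≡ (y , y≈)) x⊑
               (subst (λ s → embed z ⊑ pt i s) t′≡ ⊑y) comparable)
          where
          comparable : ∀ s → Image (pt i s) → pt i s ⊑ embed z ⊎ embed z ⊑ pt i s
          comparable s (w , w≈) = Sum.map
            (λ w⊑z → Q.trans (Q.reflexive (Q.Eq.sym w≈)) (mono-⊑ w⊑z))
            (λ z⊑w → Q.trans (mono-⊑ z⊑w) (Q.reflexive w≈))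
            (cmp (l⊆ (s , w≈)))
          distance : ∀ {t t′} → t ≤ t′ → t′ ≡ + ∣ t′ - t ∣ + t
          distance {t} {t′} t≤t′ =
            trans (e t t′) (cong (λ c → c + t) (sym (ℤ.0≤i⇒+∣i∣≡i (ℤ.i≤j⇒0≤j-i t≤t′))))
            where
            e : ∀ t t′ → t′ ≡ t′ - t + t
            e = solve-∀

        cover : IsChainCover Lines
        cover = record { isChainPartition = partition ; saturated = saturated-line }

      Positions : ℤ → Pred ℤ 0ℓ
      Positions i t = Image (pt i t)

      point : ∀ {i} → ∃ (Positions i) → ∃ (lineOf i)
      point (t , w , w≈) = w , t , w≈

      position : ∀ {i} → ∃ (lineOf i) → ∃ (Positions i)
      position (w , t , w≈) = t , w , w≈

      position-injective : ∀ {i} (x y : ∃ (lineOf i)) →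
        proj₁ (position x) ≡ proj₁ (position y) → proj₁ x R.≈ proj₁ y
      position-injective {i} (_ , t , x≈) (_ , t′ , y≈) eq =
        cancel-≈ (Q.Eq.trans x≈ (subst (λ s → pt i s ≈ _) (sym eq) (Q.Eq.sym y≈)))

      point-injective : ∀ {i} (s t : ∃ (Positions i)) →
        proj₁ (point s) R.≈ proj₁ (point t) → proj₁ s ≡ proj₁ t
      point-injective (_ , _ , v≈) (_ , _ , w≈) eq =
        injectiveʳ (Q.Eq.trans (Q.Eq.sym v≈) (Q.Eq.trans (cong-≈ eq) w≈))

      index : ∀ {i} → ∃ (Positions i) → Fin (length xs)
      index (_ , w , _) = Any.index (enumerates w)

      index-inj : ∀ {i} (s t : ∃ (Positions i)) → index s ≡ index t → proj₁ s ≡ proj₁ t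
      index-inj s@(_ , v , _) t@(_ , w , _) eq =
        point-injective s t (index-injective R.Eq.setoid (enumerates v) (enumerates w) eq)

      module _ {i : ℤ} where

        private
          S = Poset.Eq.setoid (Induced R (lineOf i))

        module _ (π : Inverse S S) where

          open Inverse π

          forth back : ∃ (Positions i) → ∃ (Positions i)
          forth = position ∘ to ∘ point
          back  = position ∘ from ∘ point

          forth-injective : ∀ s t → proj₁ (forth s) ≡ proj₁ (forth t) → proj₁ s ≡ proj₁ t
          forth-injective s t eq = point-injective s t
            (R.Eq.trans (R.Eq.sym (strictlyInverseʳ (point s)))
            (R.Eq.trans (from-cong (position-injective (to (point s)) (to (point t)) eq))
            (strictlyInverseʳ (point t))))

          back-injective : ∀ s t → proj₁ (back s) ≡ proj₁ (back t) → proj₁ s ≡ proj₁ t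
          back-injective s t eq = point-injective s t
            (R.Eq.trans (R.Eq.sym (strictlyInverseˡ (point s)))
            (R.Eq.trans (to-cong (position-injective (from (point s)) (from (point t)) eq))
            (strictlyInverseˡ (point t))))

      module _ {a ℓ₁ ℓ₂ : Level} (L : TotalOrder a ℓ₁ ℓ₂) where

        open Labelled L
        open Func using (to)
        open TotalOrder L using () renaming (_≤_ to _≤ᴸ_)

        crossing⇒≤ : (μ ρ : Labelling) →
          ∀ {i i′ x y j} → i ≤ i′ → embed x ≈ pt i j → embed y ≈ pt i′ j →
          (π : PermutedOn (lineOf i) μ ρ) (π′ : PermutedOn (lineOf i′) μ ρ) →
          (∀ {c} → c ∈ Crosses → NonDecreasingOn c μ) →
          NonDecreasingOn (lineOf i) ρ → NonDecreasingOn (lineOf i′) ρ →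
          (t : ∃ (Positions i′)) (s∈ : Image (pt i (proj₁ (forth (proj₁ π′) t)))) →
          proj₁ t ≤ j → j ≤ proj₁ (back (proj₁ π) (_ , s∈)) →
          to ρ x ≤ᴸ to ρ y
        crossing⇒≤ μ ρ {i} {i′} {x} {y} {j} i≤i′ x≈ y≈ (π , ρ≈) (π′ , ρ≈′) μ↗ ρ↗ ρ↗′ t s∈ t≤j j≤u =
          begin
          to ρ x                         ≤⟨ ρ↗ (j , x≈) (proj₂ û) (below x≈ (proj₂ (proj₂ û)) ℤ.≤-refl j≤u) ⟩
          to ρ (proj₁ û)                 ≈⟨ ρ≈ û ⟩
          to μ (proj₁ (Inverse.to π û))  ≈⟨ Func.cong μ (Inverse.strictlyInverseˡ π (point (s , s∈))) ⟩
          to μ (proj₁ s∈)                ≤⟨ μ↗ {crossOf s} ((_ , i , proj₂ s∈) , s , id , id)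
                                              (i , proj₂ s∈) (i′ , proj₂ (proj₂ ŝ))
                                              (below (proj₂ s∈) (proj₂ (proj₂ ŝ)) i≤i′ ℤ.≤-refl) ⟩
          to μ (proj₁ ŝ)                 ≈⟨ ρ≈′ (point t) ⟨
          to ρ (proj₁ (point t))         ≤⟨ ρ↗′ (proj₂ (point t)) (j , y≈) (below (proj₂ (proj₂ t)) y≈ ℤ.≤-refl t≤j) ⟩
          to ρ y                         ∎
          where
          open ≤-Reasoning (TotalOrder.poset L)
          ŝ = Inverse.to π′ (point t)
          s = proj₁ (position ŝ)
          û = Inverse.from π (point (s , s∈))
          below : ∀ {v w i i′ t t′} → embed v ≈ pt i t → embed w ≈ pt i′ t′ → i ≤ i′ → t ≤ t′ → v R.≤ w
          below v≈ w≈ i≤i′ t≤t′ = cancel-⊑ (⊑-resp-≈ v≈ w≈ (mono i≤i′ t≤t′))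

        sort-crosses-then-lines : SortThenSort Crosses Lines
        sort-crosses-then-lines {ν} {μ} {ρ} sorted-μ sorted-ρ (_ , j , ⊆c , _) {x} {y} x∈c y∈c x⊑y =
          let (i , x≈)   = ⊆c x∈c
              (i′ , y≈)  = ⊆c y∈c
              i≤i′       = reflectsˡ (⊑-resp-≈ (Q.Eq.sym x≈) (Q.Eq.sym y≈) (mono-⊑ x⊑y))
              (π , ρ↗)   = sorted-ρ {lineOf i} ((x , j , x≈) , i , id , id)
              (π′ , ρ↗′) = sorted-ρ {lineOf i′} ((y , j , y≈) , i′ , id , id)
              (t , s∈ , t≤j , j≤u) =
                Chase.∃-crossing {Positions i} {Positions i′} (λ t → Image? (pt i t)) j
                  (λ t≤j r → Image-convex r (y , y≈) (mono i≤i′ ℤ.≤-refl) (mono ℤ.≤-refl t≤j))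
                  (λ j≤t r → Image-convex (x , x≈) r (mono ℤ.≤-refl j≤t) (mono i≤i′ ℤ.≤-refl))
                  (forth (proj₁ π′)) (forth-injective (proj₁ π′))
                  (back (proj₁ π)) (back-injective (proj₁ π)) index index-inj (y , y≈)
          in crossing⇒≤ μ ρ i≤i′ x≈ y≈ π π′ (λ c∈ → proj₂ (sorted-μ c∈)) ρ↗ ρ↗′ t s∈ t≤j j≤u

      edges : EdgesIn Crosses Lines
      edges {x} {y} ((x⊑y , _) , ¬between)
        with i , t , i′ , t′ , x≈ , y≈ , i≤i′ , t≤t′ ← lifts (mono-⊑ x⊑y)
        with i ≟ i′ | t ≟ t′
      ... | yes refl | _ = lineOf i , inj₂ ((x , t , x≈) , i , id , id) , (t , x≈) , t′ , y≈
      ... | no _ | yes refl = crossOf t , inj₁ ((x , i , x≈) , t , id , id) , (i , x≈) , i′ , y≈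
      ... | no i≢i′ | no t≢t′ = contradiction (corner , (x⊑c , x≉c) , (c⊑y , c≉y)) ¬between
        where
        x⊑pt = Q.trans (Q.reflexive x≈) (mono i≤i′ ℤ.≤-refl)
        pt⊑y = Q.trans (mono ℤ.≤-refl t≤t′) (Q.reflexive (Q.Eq.sym y≈))
        corner∈ = convex x y x⊑pt pt⊑y
        corner = proj₁ corner∈
        c≈ = proj₂ corner∈
        x⊑c : x R.≤ corner
        x⊑c = cancel-⊑ (Q.trans x⊑pt (Q.reflexive (Q.Eq.sym c≈)))
        c⊑y : corner R.≤ y
        c⊑y = cancel-⊑ (Q.trans (Q.reflexive c≈) pt⊑y)
        x≉c : ¬ x R.≈ corner
        x≉c x≈c = i≢i′ (injectiveˡ (Q.Eq.trans (Q.Eq.sym x≈) (Q.Eq.trans (cong-≈ x≈c) c≈)))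
        c≉y : ¬ corner R.≈ y
        c≉y c≈y = t≢t′ (injectiveʳ (Q.Eq.trans (Q.Eq.sym c≈) (Q.Eq.trans (cong-≈ c≈y) y≈)))

    module _ {a ℓ₁ ℓ₂ : Level} (L : TotalOrder a ℓ₁ ℓ₂) where

      open Labelled L

      nonMessingUp : (C : Coordinates) → NonMessingUp (Preimages.Crosses embed C) (Preimages.Lines embed C)
      nonMessingUp C = record
        { sort₁₂ = λ {ν} {μ} {ρ} → Along.sort-crosses-then-lines C L {ν} {μ} {ρ}
        ; sort₂₁ = λ {ν} {μ} {ρ} → Along.sort-crosses-then-lines (transpose C) L {ν} {μ} {ρ}
        ; edges  = Along.edges C
        }

module _ (k n : ℤ) (0<k : 0ℤ < k) (k<n : k < n) where

  open Cylinder k n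
  open Grid (Cyl 0<k k<n)

  private
    instance
      k-pos : Positive k
      k-pos = positive 0<k

      n-k-pos : Positive (n - k)
      n-k-pos = positive (subst (_< n - k) (ℤ.+-inverseʳ k) (ℤ.+-monoˡ-< (- k) k<n))

  shift≼ : ∀ m z → shift m z ≼ z
  shift≼ m z = z , z , ∼-sym z (shift m z) (m , refl) , ∼-refl z , ℤ.≤-refl , ℤ.≤-refl

  _∼?_ : ∀ x y → Dec (x ∼ y)
  (i , j) ∼? (i′ , j′) with (n - k) ∣? (j′ - j)
  ... | no ∤ = no λ where (m , refl) → ∤ (divides m (e j (m * (n - k))))
    where
    e : ∀ j d → j + d - j ≡ d
    e = solve-∀
  ... | yes (divides q eq) = map′ (q ,_) unique (≡-dec _≟_ _≟_ _ _)
    where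
    e : ∀ j d → j + d - j ≡ d
    e = solve-∀
    unique : (i , j) ∼ (i′ , j′) → (i′ , j′) ≡ shift q (i , j)
    unique (m , refl) = cong (λ m → shift m (i , j))
      (ℤ.*-cancelʳ-≡ m q (n - k) {{>-nonZero (ℤ.positive⁻¹ (n - k))}} (trans (sym (e j (m * (n - k)))) eq))

  coordinates : Coordinates
  coordinates = record
    { pt        = _,_
    ; lifts     = λ {x} {y} x≼y → let (m , i≤i′ , j≤j′) = ≼-shift x y x≼y in
        proj₁ x , proj₂ x , proj₁ (shift m y) , proj₂ (shift m y) , ∼-refl x , (m , refl) , i≤i′ , j≤j′
    ; mono      = λ {i} {i′} {t} {t′} i≤i′ t≤t′ →
        (i , t) , (i′ , t′) , ∼-refl (i , t) , ∼-refl (i′ , t′) , i≤i′ , t≤t′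
    ; reflectsˡ = λ {i} {i′} {t} p → let (m , q , r) = ≼-shift (i , t) (i′ , t) p in
        ℤ.≤-trans q (-nonNeg*≤ i′ k (≤+*⇒nonNeg m (n - k) r (i<i+pos t (n - k))))
    ; reflectsʳ = λ {i} {t} {t′} p → let (m , q , r) = ≼-shift (i , t) (i , t′) p in
        ℤ.≤-trans r (+nonPos*≤ t′ (n - k) (≤-*⇒nonPos m k q (i<i+pos i k)))
    ; parallelˡ = λ where (m , refl) s → s - m * k , m , refl
    ; parallelʳ = λ where (m , refl) s → s + m * (n - k) , m , refl
    }

  coordinatesᵀ : Coordinates
  coordinatesᵀ = transpose coordinates

  -- If pt t ≼ z ≼ pt (1 + t), a lift of z above pt t lies below a translate by m′
  -- of pt (1 + t); a unit step is too short for m′ ≠ 0 to be possible.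
  vertical-stepsCover : 1ℤ < n - k → Coordinates.StepsCover coordinates
  vertical-stepsCover 1<n-k i t z t≼z z≼t+1 =
    let (m , p , r)    = ≼-shift (i , t) z t≼z
        (m′ , p′ , r′) = ≼-shift (shift m z) (i , 1ℤ + t)
          (≼-trans (shift m z) z (i , 1ℤ + t) (shift≼ m z) z≼t+1)
        0≤m′           = ≤+*⇒nonNeg m′ (n - k) (ℤ.≤-trans r r′)
          (subst (1ℤ + t <_) (ℤ.+-comm (n - k) t) (ℤ.+-monoˡ-< t 1<n-k))
    in proj₂ (shift m z) , m ,
       cong (_, proj₂ (shift m z)) (ℤ.≤-antisym p (ℤ.≤-trans p′ (-nonNeg*≤ i k 0≤m′)))

  horizontal-stepsCover : 1ℤ < k → Coordinates.StepsCover coordinatesᵀ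
  horizontal-stepsCover 1<k j t z t≼z z≼t+1 =
    let (m , p , r)    = ≼-shift (t , j) z t≼z
        (m′ , p′ , r′) = ≼-shift (shift m z) (1ℤ + t , j)
          (≼-trans (shift m z) z (1ℤ + t , j) (shift≼ m z) z≼t+1)
        m′≤0           = ≤-*⇒nonPos m′ k (ℤ.≤-trans p p′)
          (subst (1ℤ + t <_) (ℤ.+-comm k t) (ℤ.+-monoˡ-< t 1<k))
    in proj₁ (shift m z) , m ,
       cong (proj₁ (shift m z) ,_) (ℤ.≤-antisym r (ℤ.≤-trans r′ (+nonPos*≤ j (n - k) m′≤0)))

  k≡1⇒single-vertical : k ≡ 1ℤ → ∀ i x → x ∈ VerticalLine i
  k≡1⇒single-vertical refl i (a , b) =
    b + (a - i) * (n - 1ℤ) , a - i , cong (_, b + (a - i) * (n - 1ℤ)) (e a i)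
    where
    e : ∀ a i → i ≡ a - (a - i) * 1ℤ
    e = solve-∀

  n-k≡1⇒single-horizontal : n - k ≡ 1ℤ → ∀ j x → x ∈ HorizontalLine j
  n-k≡1⇒single-horizontal n-k≡1 j (a , b) =
    a - (j - b) * k , j - b , cong (a - (j - b) * k ,_)
      (trans (e b j) (cong (λ d → b + (j - b) * d) (sym n-k≡1)))
    where
    e : ∀ b j → j ≡ b + (j - b) * 1ℤ
    e = solve-∀

  total-or-wide : ∀ {a} {A : Set a} → ((∀ x y → x ≼ y ⊎ y ≼ x) → A) → (1ℤ < k → 1ℤ < n - k → A) → A
  total-or-wide total wide with ℤ.<-cmp 1ℤ k | ℤ.<-cmp 1ℤ (n - k)
  ... | tri< 1<k _ _ | tri< 1<n-k _ _ = wide 1<k 1<n-k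
  ... | tri≈ _ 1≡k _ | _ = total λ x y → Coordinates.Line-comparable coordinates {0ℤ} {x} {y}
    (k≡1⇒single-vertical (sym 1≡k) 0ℤ x) (k≡1⇒single-vertical (sym 1≡k) 0ℤ y)
  ... | tri> _ _ k<1 | _ = contradiction (ℤ.i<j⇒suc[i]≤j 0<k) (ℤ.<⇒≱ k<1)
  ... | tri< _ _ _ | tri≈ _ 1≡n-k _ = total λ x y → Coordinates.Line-comparable coordinatesᵀ {0ℤ} {x} {y}
    (n-k≡1⇒single-horizontal (sym 1≡n-k) 0ℤ x) (n-k≡1⇒single-horizontal (sym 1≡n-k) 0ℤ y)
  ... | tri< _ _ _ | tri> _ _ <1 = contradiction (ℤ.i<j⇒suc[i]≤j (ℤ.positive⁻¹ (n - k))) (ℤ.<⇒≱ <1)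

  n≡2⇒k≡1 : n ≡ + 2 → k ≡ 1ℤ
  n≡2⇒k≡1 n≡2 = ℤ.≤-antisym (ℤ.i<j⇒i≤pred[j] (subst (k <_) n≡2 k<n)) (ℤ.i<j⇒suc[i]≤j 0<k)

  module _ {R : Poset 0ℓ 0ℓ 0ℓ} {embed : Poset.Carrier R → ℤ × ℤ} {a ℓ₁ ℓ₂ : Level} (L : TotalOrder a ℓ₁ ℓ₂)
    (E : IsConvexEmbedding R embed) (finite : Finite (Poset.Eq.setoid R)) where

    open Families E _∼?_ finite
    open PosetNotions R
    open Labelled L
    open Coordinates using (StepsCover)
    open Preimages embed coordinates using () renaming (Lines to Verticals; Crosses to Horizontals)

    verticals-partition : IsChainPartition Verticals
    verticals-partition = Along.partition coordinates

    horizontals-partition : IsChainPartition Horizontals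
    horizontals-partition = Along.partition coordinatesᵀ

    horizontals-verticals-nonMessingUp : NonMessingUp Horizontals Verticals
    horizontals-verticals-nonMessingUp = nonMessingUp L coordinates

    stepsCover⇒InN₂Via : StepsCover coordinatesᵀ → StepsCover coordinates → InN₂Via Horizontals Verticals
    stepsCover⇒InN₂Via h v = record
      { finite       = finite
      ; cover₁       = Along.cover coordinatesᵀ h
      ; cover₂       = Along.cover coordinates v
      ; nonMessingUp = horizontals-verticals-nonMessingUp
      }

    unitStepsCover⇒InN₂Via : UnitStepsCover → InN₂Via Horizontals Verticals
    unitStepsCover⇒InN₂Via (inj₁ (1<k , 1<n-k)) =
      stepsCover⇒InN₂Via (horizontal-stepsCover 1<k) (vertical-stepsCover 1<n-k)
    unitStepsCover⇒InN₂Via (inj₂ n≡2) = stepsCover⇒InN₂Via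
      (λ j _ z _ _ → n-k≡1⇒single-horizontal (cong₂ _-_ n≡2 (n≡2⇒k≡1 n≡2)) j z)
      (λ i _ z _ _ → k≡1⇒single-vertical (n≡2⇒k≡1 n≡2) i z)

theorem2p9 :
    ∀ {a ℓ₁ ℓ₂ : Level} (L : TotalOrder a ℓ₁ ℓ₂)
      (k n : ℤ) (0<k : 0ℤ < k) (k<n : k < n) →
    let open Cylinder k n
        Cylₖₙ = Cyl 0<k k<n
    in
    (P : Pred (Poset.Carrier Cylₖₙ) 0ℓ) →
    P Respects (Poset._≈_ Cylₖₙ) →
    PosetNotions.IsConvex Cylₖₙ P →
    Finite (Poset.Eq.setoid (Induced Cylₖₙ P)) →
    let open PosetNotions (Induced Cylₖₙ P)
        open Labelled L
    in
    InN₂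
    × (UnitStepsCover → InN₂Via (Rows P) (Columns P))
    × (IsChainPartition (Rows P) × IsChainPartition (Columns P) × NonMessingUp (Rows P) (Columns P))
theorem2p9 L k n 0<k k<n P resp convex finite =
  total-or-wide k n 0<k k<n
    (λ total → Whole , Whole , chain⇒InN₂Via L finite λ x y → total (proj₁ x) (proj₁ y))
    (λ 1<k 1<n-k → Rows P , Columns P ,
      unitStepsCover⇒InN₂Via k n 0<k k<n L (isConvexEmbedding id id id id between) finite (inj₁ (1<k , 1<n-k))) ,
  unitStepsCover⇒InN₂Via k n 0<k k<n L (isConvexEmbedding id id id id between) finite ,
  horizontals-partition k n 0<k k<n L (isConvexEmbedding id id id id between) finite ,
  verticals-partition k n 0<k k<n L (isConvexEmbedding id id id id between) finite ,
  horizontals-verticals-nonMessingUp k n 0<k k<n L (isConvexEmbedding id id id id between) finite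
  where
  open Grid using (isConvexEmbedding)
  open Cylinder k n using (_∼_; _≼_; ∼-refl; Rows; Columns)
  between : ∀ (x y : ∃ P) {z} → proj₁ x ≼ z → z ≼ proj₁ y → ∃[ w ] proj₁ {B = P} w ∼ z
  between (x , p) (y , q) {z} x≼z z≼y = (z , convex {x} {y} {z} p q x≼z z≼y) , ∼-refl z
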